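{- Let $d\ge 1$ and $h\ge 1$ be integers and let $T$ be a $d$-ary tree of height $h$. Then $T$ has a $(\leq 2d(d+1)^{h-1})$-subdivision $S$ with $\phi(S)\le 10$.
   Context: An anagram is a word of the form $WP$ where $W$ is a non-empty word and $P$ is a permutation of $W$. A vertex colouring of a graph is anagram-free if the sequence of colours along every path of the graph is not an anagram. $\phi(G)$ denotes the minimum number of colours in an anagram-free colouring of $G$. A subdivision of $G$ is obtained by replacing each edge $uv$ by a path with endpoints $u,v$; internal vertices of these paths are division vertices. A $(\le k)$-subdivision is a subdivision in which every edge receives at most $k$ division vertices. A $d$-ary tree is a rooted tree in which every vertex has at most $d$ children; its height is the maximum distance from the root to a vertex. -}

module Defs where

open import Data.Nat using (ℕ; zero; suc; _≤_; _⊔_)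
open import Data.Fin using (Fin)
open import Data.List using (List; []; _∷_; length; lookup; map; _++_)
open import Data.List.Relation.Unary.All using (All)
open import Data.List.Relation.Unary.Linked using (Linked)
open import Data.List.Relation.Unary.Unique.Propositional using (Unique)
open import Data.List.Relation.Binary.Pointwise using (Pointwise)
open import Data.List.Relation.Binary.Permutation.Propositional using (_↭_)
open import Data.Product using (Σ; _×_; ∃)
open import Data.Sum using (_⊎_)
open import Relation.Binary.PropositionalEquality using (_≡_; _≢_)
open import Relation.Nullary using (¬_)

data Tree : Set where
  node : List Tree → Tree

data Pos : Tree → Set where
  here  : ∀ {t} → Pos t
  there : ∀ {ts} (i : Fin (length ts)) → Pos (lookup ts i) → Pos (node ts)

data _⋖_ : ∀ {t} → Pos t → Pos t → Set where
  root  : ∀ {ts} (i : Fin (length ts)) → here {node ts} ⋖ there i here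
  step  : ∀ {ts} (i : Fin (length ts)) {p q : Pos (lookup ts i)} →
          p ⋖ q → there {ts} i p ⋖ there {ts} i q

Adj : ∀ {t} → Pos t → Pos t → Set
Adj p q = p ⋖ q ⊎ q ⋖ p

IsPath : ∀ {t} → List (Pos t) → Set
IsPath ps = Unique ps × Linked Adj ps

Anagram : ∀ {A : Set} → List A → Set
Anagram {A} xs = Σ (List A) λ W → Σ (List A) λ P → W ≢ [] × P ↭ W × xs ≡ W ++ P

AnagramFree : ∀ {k} (t : Tree) → (Pos t → Fin k) → Set
AnagramFree t c = ∀ (ps : List (Pos t)) → IsPath ps → ¬ Anagram (map c ps)

data DAry (d : ℕ) : Tree → Set where
  node : ∀ {ts} → length ts ≤ d → All (DAry d) ts → DAry d (node ts)

mutual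
  height : Tree → ℕ
  height (node ts) = heights ts

  heights : List Tree → ℕ
  heights [] = 0
  heights (t ∷ ts) = suc (height t) ⊔ heights ts

chain : ℕ → Tree → Tree
chain zero s = s
chain (suc j) s = node (chain j s ∷ [])

-- Subdiv k T S : S is a (≤ k)-subdivision of T (each edge parent→child of T
-- is replaced by a path with j ≤ k division vertices).
data Subdiv (k : ℕ) : Tree → Tree → Set where
  node : ∀ {ts ss} →
         Pointwise (λ t s → Σ ℕ λ j → j ≤ k × Σ Tree λ s' → s ≡ chain j s' × Subdiv k t s') ts ss →
         Subdiv k (node ts) (node ss)

{-# OPTIONS --safe #-}
module Submission where

open import Defs
open import Data.Nat using (ℕ; suc; _≤_; _*_; _^_; _∸_)
open import Data.Fin using (Fin)
open import Data.Product using (Σ; _×_)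
open import Relation.Binary.PropositionalEquality using (_≡_)

open import Data.Bool using (Bool; true; false; T; not; _∧_; _∨_; _xor_)
open import Data.Bool.Properties using (T-∧; T-∨)
open import Data.Empty using (⊥; ⊥-elim)
open import Data.Fin using (zero; suc; toℕ; #_)
open import Data.Fin.Properties using (toℕ<n; toℕ-injective)
open import Data.List using (List; []; _∷_; _++_; applyUpTo; length; lookup; map; reverse; reverseAcc)
open import Data.List.Properties using (map-∘; map-cong; map-++; reverse-++; unfold-reverse; ++-assoc; ∷-injectiveˡ; ∷-injectiveʳ)
open import Data.List.Relation.Binary.Permutation.Propositional using (_↭_; ↭-sym; ↭⇒↭ₛ)
open import Data.List.Relation.Binary.Permutation.Propositional.Properties using (↭-reverse; All-resp-↭) renaming (map⁺ to ↭-map⁺)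
open import Data.List.Relation.Binary.Permutation.Setoid.Properties using (Unique-resp-↭)
open import Data.List.Relation.Binary.Pointwise using (Pointwise; []; _∷_; Pointwise-length)
open import Data.List.Relation.Unary.All as All using (All; []; _∷_)
import Data.List.Relation.Unary.All.Properties as All
open import Data.List.Relation.Unary.AllPairs using ([]; _∷_)
open import Data.List.Relation.Unary.Linked as Linked using (Linked; []; [-]; _∷_)
import Data.List.Relation.Unary.Linked.Properties as Linked
open import Data.List.Relation.Unary.Unique.Propositional using (Unique)
import Data.List.Relation.Unary.Unique.Propositional.Properties as Unique
open import Data.Nat using (zero; _+_; _<_; _≡ᵇ_; NonZero; z≤n; s≤s; s≤s⁻¹)
open import Data.Nat.DivMod
open import Data.Nat.Divisibility using (divides-refl)
open import Data.Nat.Induction using (<-rec)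
open import Data.Nat.ListAction using (sum)
open import Data.Nat.ListAction.Properties using (sum-↭; sum-++)
open import Data.Nat.Properties
open import Data.Nat.Tactic.RingSolver using (solve-∀)
open import Data.Product using (_,_; ∃; ∃₂; proj₁; proj₂)
open import Data.Sum using (_⊎_; inj₁; inj₂; map₂; swap)
open import Data.Unit using (tt)
open import Function.Base using (_∘_)
open import Function.Bundles using (Equivalence)
open import Relation.Binary.Definitions using (Symmetric; tri<; tri≈; tri>)
open import Relation.Binary.PropositionalEquality using (_≢_; refl; sym; trans; cong; cong₂; subst; subst₂; setoid; module ≡-Reasoning)
open import Relation.Nullary using (¬_)

-- The division vertices along every downward path are coloured by consecutive letters of Keränen's
-- abelian square-free word w on four letters, taken from one copy of the alphabet on the upper half
-- of each edge and from a second copy on the lower half; original vertices get a ninth colour. So an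
-- anagram on a downward path would give an abelian square in w. At the root of a subtree of height
-- m + 1 the i-th edge has i (d + 1)^m vertices in each half, so that sibling edges differ by more
-- than the number of upper (or lower) vertices on any downward path further below. If a path turns
-- at a vertex, the half avoiding that vertex lies in one branch, and it passes the end of the first
-- edge there because both halves contain equally many original vertices. Comparing the numbers of
-- upper and of lower vertices in the two halves then contradicts the gap between sibling edges.
--
-- For w, cut points i, j, k of a square are written as r + 85 q. A weight under which all blocks
-- vanish modulo 511 leaves few possible triples of (letter, r), and a finite computation shows that
-- each of these can be rounded to block boundaries, down or up, without disturbing the balance. As
-- the matrix of letter counts of the blocks is invertible, this gives a balanced triple of smaller
-- indices, which is constant by induction; then either i = j or two letters contradict each other.

-- Keränen's word

data Letter : Set where
  α β γ δ : Letter

next : Letter → Letter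
next α = β
next β = γ
next γ = δ
next δ = α

-- Addition in the cyclic group of order 4 with zero `α`; cyclic shifts of an image become
-- translations by a letter.
_⊕_ : Letter → Letter → Letter
α ⊕ y = y
β ⊕ y = next y
γ ⊕ y = next (next y)
δ ⊕ y = next (next (next y))

𝟙 : Letter → Letter → ℕ
𝟙 α α = 1
𝟙 β β = 1
𝟙 γ γ = 1
𝟙 δ δ = 1
𝟙 _ _ = 0

nth : ∀ {A : Set} → A → List A → ℕ → A
nth z []       _       = z
nth z (x ∷ xs) zero    = x
nth z (x ∷ xs) (suc i) = nth z xs i

nth-applyUpTo : ∀ {A : Set} (z : A) f {n i} → i < n → nth z (applyUpTo f n) i ≡ f i
nth-applyUpTo z f {i = zero}  (s≤s _) = refl
nth-applyUpTo z f {i = suc i} (s≤s p) = nth-applyUpTo z (f ∘ suc) p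

-- The image of α under Keränen's morphism; the images of β, γ, δ are its cyclic shifts.
keränen : List Letter
keränen =
  α ∷ β ∷ γ ∷ α ∷ γ ∷ δ ∷ γ ∷ β ∷ γ ∷ δ ∷ γ ∷ α ∷ δ ∷ γ ∷ δ ∷ β ∷ δ ∷
  α ∷ β ∷ α ∷ γ ∷ α ∷ β ∷ α ∷ δ ∷ β ∷ α ∷ β ∷ γ ∷ β ∷ δ ∷ β ∷ γ ∷ β ∷
  α ∷ γ ∷ β ∷ γ ∷ δ ∷ γ ∷ α ∷ γ ∷ β ∷ α ∷ β ∷ δ ∷ α ∷ β ∷ α ∷ γ ∷ α ∷
  δ ∷ γ ∷ β ∷ γ ∷ δ ∷ γ ∷ α ∷ γ ∷ δ ∷ β ∷ γ ∷ β ∷ α ∷ γ ∷ β ∷ γ ∷ δ ∷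
  γ ∷ α ∷ γ ∷ δ ∷ γ ∷ β ∷ δ ∷ γ ∷ δ ∷ α ∷ δ ∷ β ∷ δ ∷ γ ∷ β ∷ γ ∷ α ∷ []

g : ℕ → Letter
g = nth α keränen

-- The fixed point of the morphism: its n-th letter is the sum of g over the base-85 digits of n.
-- The first argument is fuel.
digits : ℕ → ℕ → Letter
digits zero    n = α
digits (suc f) n = digits f (n / 85) ⊕ g (n % 85)

w : ℕ → Letter
w n = digits n n

n/85≤f : ∀ {n f} → n ≤ suc f → n / 85 ≤ f
n/85≤f {zero}  _ = z≤n
n/85≤f {suc n} p = s≤s⁻¹ (≤-trans (m/n<m (suc n) 85 (s≤s (s≤s z≤n))) p)

-- Surplus fuel only reads leading zero digits, and each of these adds `g 0`, the neutral letter
-- `α`.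
digits-fuel : ∀ f f′ {n} → n ≤ f → n ≤ f′ → digits f n ≡ digits f′ n
digits-fuel zero     zero     _   _ = refl
digits-fuel zero     (suc f′) z≤n q = cong (_⊕ α) (digits-fuel zero f′ z≤n z≤n)
digits-fuel (suc f)  zero     p z≤n = cong (_⊕ α) (digits-fuel f zero z≤n z≤n)
digits-fuel (suc f)  (suc f′) {n} p q = cong (_⊕ g (n % 85)) (digits-fuel f f′ (n/85≤f p) (n/85≤f q))

w-step : ∀ n → w n ≡ w (n / 85) ⊕ g (n % 85)
w-step n = trans (digits-fuel n (suc n) ≤-refl (n≤1+n n))
                 (cong (_⊕ g (n % 85)) (digits-fuel n (n / 85) (m/n≤m n 85) ≤-refl))

[r+q*k]/k≡q : ∀ q {r k} .{{_ : NonZero k}} → r < k → (r + q * k) / k ≡ q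
[r+q*k]/k≡q q {r} {k} r<k = trans (+-distrib-/-∣ʳ r (divides-refl q))
                                  (cong₂ _+_ (m<n⇒m/n≡0 r<k) (m*n/n≡m q k))

[r+q*k]%k≡r : ∀ q {r k} .{{_ : NonZero k}} → r < k → (r + q * k) % k ≡ r
[r+q*k]%k≡r q {r} {k} r<k = trans ([m+kn]%n≡m%n r q k) (m<n⇒m%n≡m r<k)

-- Splitting off the last base-85 digit shows that `w` is a fixed point: `w q` determines the 85
-- letters from `q * 85` on.
w-block : ∀ q {r} → r < 85 → w (r + q * 85) ≡ w q ⊕ g r
w-block q {r} r<85 = trans (w-step (r + q * 85))
  (cong₂ (λ x y → w x ⊕ g y) ([r+q*k]/k≡q q r<85) ([r+q*k]%k≡r q r<85))

-- Prefix weights of the word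

Weight : Set
Weight = Letter → ℕ

total : (ℕ → Letter) → Weight → ℕ → ℕ
total f ω zero    = 0
total f ω (suc n) = total f ω n + ω (f n)

S : Weight → ℕ → ℕ
S = total w

image : Letter → ℕ → Letter
image x t = x ⊕ g t

-- The transpose of the incidence matrix of the morphism: the weight of a word under `star ω` is
-- that of its image under `ω`.
star : Weight → Weight
star ω x = total (image x) ω 85

S-block : ∀ ω q r → r ≤ 85 → S ω (r + q * 85) ≡ S (star ω) q + total (image (w q)) ω r
S-block ω zero    zero    _ = refl
S-block ω (suc q) zero    _ = trans (S-block ω q 85 ≤-refl) (sym (+-identityʳ _))
S-block ω q       (suc r) p =
  trans (cong₂ _+_ (S-block ω q r (<⇒≤ p)) (cong ω (w-block q p))) (+-assoc (S (star ω) q) _ _)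

S-ext : ∀ {ω ω′} → (∀ x → ω x ≡ ω′ x) → ∀ n → S ω n ≡ S ω′ n
S-ext e zero    = refl
S-ext e (suc n) = cong₂ _+_ (S-ext e n) (e (w n))

+-interchange : ∀ p q r s → p + q + (r + s) ≡ p + r + (q + s)
+-interchange = solve-∀

S-+ : ∀ ω ω′ n → S (λ x → ω x + ω′ x) n ≡ S ω n + S ω′ n
S-+ ω ω′ zero    = refl
S-+ ω ω′ (suc n) = trans (cong (_+ (ω (w n) + ω′ (w n))) (S-+ ω ω′ n))
                         (+-interchange (S ω n) (S ω′ n) (ω (w n)) (ω′ (w n)))

S-* : ∀ k ω n → S (λ x → k * ω x) n ≡ k * S ω n
S-* k ω zero    = sym (*-zeroʳ k)
S-* k ω (suc n) = trans (cong (_+ k * ω (w n)) (S-* k ω n)) (sym (*-distribˡ-+ k (S ω n) (ω (w n))))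

one : Weight
one _ = 1

S-one : ∀ n → S one n ≡ n
S-one zero    = refl
S-one (suc n) = trans (cong (_+ 1) (S-one n)) (+-comm n 1)

-- For i ≤ j ≤ k: the factors of w between i and j and between j and k have the same weight. With
-- all weights, these factors are permutations of each other.
record Balanced (i j k : ℕ) (ω : Weight) : Set where
  constructor balanced
  field sums : S ω i + S ω k ≡ 2 * S ω j

open Balanced

-- Linear combinations of balanced weights

combine : Weight → (Letter → Weight) → Weight
combine κ ω x = κ α * ω α x + (κ β * ω β x + (κ γ * ω γ x + κ δ * ω δ x))

𝟙-spans : ∀ ω x → combine ω 𝟙 x ≡ ω x
𝟙-spans ω α = l (ω α) (ω β) (ω γ) (ω δ)
  where
  l : ∀ p q r s → p * 1 + (q * 0 + (r * 0 + s * 0)) ≡ p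
  l = solve-∀
𝟙-spans ω β = l (ω α) (ω β) (ω γ) (ω δ)
  where
  l : ∀ p q r s → p * 0 + (q * 1 + (r * 0 + s * 0)) ≡ q
  l = solve-∀
𝟙-spans ω γ = l (ω α) (ω β) (ω γ) (ω δ)
  where
  l : ∀ p q r s → p * 0 + (q * 0 + (r * 1 + s * 0)) ≡ r
  l = solve-∀
𝟙-spans ω δ = l (ω α) (ω β) (ω γ) (ω δ)
  where
  l : ∀ p q r s → p * 0 + (q * 0 + (r * 0 + s * 1)) ≡ s
  l = solve-∀

module _ {i j k : ℕ} where

  bal-ext : ∀ {ω ω′} → (∀ x → ω x ≡ ω′ x) → Balanced i j k ω → Balanced i j k ω′
  bal-ext e (balanced h) =
    balanced (trans (sym (cong₂ _+_ (S-ext e i) (S-ext e k))) (trans h (cong (2 *_) (S-ext e j))))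

  bal-+ : ∀ {ω ω′} → Balanced i j k ω → Balanced i j k ω′ → Balanced i j k (λ x → ω x + ω′ x)
  bal-+ {ω} {ω′} (balanced h) (balanced h′) = balanced (begin
    S (λ x → ω x + ω′ x) i + S (λ x → ω x + ω′ x) k  ≡⟨ cong₂ _+_ (S-+ ω ω′ i) (S-+ ω ω′ k) ⟩
    S ω i + S ω′ i + (S ω k + S ω′ k)                ≡⟨ +-interchange (S ω i) (S ω′ i) (S ω k) (S ω′ k) ⟩
    S ω i + S ω k + (S ω′ i + S ω′ k)                ≡⟨ cong₂ _+_ h h′ ⟩
    2 * S ω j + 2 * S ω′ j                           ≡⟨ *-distribˡ-+ 2 (S ω j) (S ω′ j) ⟨
    2 * (S ω j + S ω′ j)                             ≡⟨ cong (2 *_) (S-+ ω ω′ j) ⟨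
    2 * S (λ x → ω x + ω′ x) j                       ∎)
    where open ≡-Reasoning

  bal-scale : ∀ m ω → S (λ x → m * ω x) i + S (λ x → m * ω x) k ≡ m * (S ω i + S ω k) ×
                      2 * S (λ x → m * ω x) j ≡ m * (2 * S ω j)
  bal-scale m ω = trans (cong₂ _+_ (S-* m ω i) (S-* m ω k)) (sym (*-distribˡ-+ m (S ω i) (S ω k)))
                , trans (cong (2 *_) (S-* m ω j)) (lemma m (S ω j))
    where
    lemma : ∀ m s → 2 * (m * s) ≡ m * (2 * s)
    lemma = solve-∀

  bal-* : ∀ m {ω} → Balanced i j k ω → Balanced i j k (λ x → m * ω x)
  bal-* m {ω} (balanced h) =
    balanced (trans (proj₁ (bal-scale m ω)) (trans (cong (m *_) h) (sym (proj₂ (bal-scale m ω)))))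

  bal-*⁻ : ∀ m .{{_ : NonZero m}} {ω} → Balanced i j k (λ x → m * ω x) → Balanced i j k ω
  bal-*⁻ m {ω} (balanced h) = balanced
    (*-cancelˡ-≡ _ _ m (trans (sym (proj₁ (bal-scale m ω))) (trans h (proj₂ (bal-scale m ω)))))

  bal-+⁻ : ∀ {ω ω′} → Balanced i j k (λ x → ω x + ω′ x) → Balanced i j k ω′ → Balanced i j k ω
  bal-+⁻ {ω} {ω′} (balanced h) (balanced h′) = balanced (+-cancelʳ-≡ (S ω′ i + S ω′ k) _ _ (begin
    S ω i + S ω k + (S ω′ i + S ω′ k)                ≡⟨ +-interchange (S ω i) (S ω k) (S ω′ i) (S ω′ k) ⟩
    S ω i + S ω′ i + (S ω k + S ω′ k)                ≡⟨ cong₂ _+_ (S-+ ω ω′ i) (S-+ ω ω′ k) ⟨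
    S (λ x → ω x + ω′ x) i + S (λ x → ω x + ω′ x) k  ≡⟨ h ⟩
    2 * S (λ x → ω x + ω′ x) j                       ≡⟨ cong (2 *_) (S-+ ω ω′ j) ⟩
    2 * (S ω j + S ω′ j)                             ≡⟨ *-distribˡ-+ 2 (S ω j) (S ω′ j) ⟩
    2 * S ω j + 2 * S ω′ j                           ≡⟨ cong (2 * S ω j +_) h′ ⟨
    2 * S ω j + (S ω′ i + S ω′ k)                    ∎))
    where open ≡-Reasoning

  bal-combine : ∀ κ ω → (∀ ℓ → Balanced i j k (ω ℓ)) → Balanced i j k (combine κ ω)
  bal-combine κ ω h = bal-+ (bal-* (κ α) (h α)) (bal-+ (bal-* (κ β) (h β))
                     (bal-+ (bal-* (κ γ) (h γ)) (bal-* (κ δ) (h δ))))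

-- A row of 511 times the inverse of the circulant matrix (star (𝟙 ℓ) x), moved by a multiple of
-- the all-ones row that makes it integral and non-negative and makes 511 divide each star ν x.
ν : Weight
ν α = 118
ν β = 120
ν γ = 174
ν δ = 99

star-ν : ∀ x → star ν x ≡ 511 * (𝟙 α x + 21)
star-ν α = refl
star-ν β = refl
star-ν γ = refl
star-ν δ = refl

opp : Letter → Letter
opp α = α
opp β = δ
opp γ = γ
opp δ = β

-- The number of letters `ℓ` in the image of `x` depends only on the difference of `ℓ` and `x`, so
-- the row for `m` is `ν` translated by `m`; `opp` is negation in the cyclic group.
star-inverse : ∀ m x → combine (λ ℓ → ν (opp m ⊕ ℓ)) (star ∘ 𝟙) x ≡ 511 * (𝟙 m x + 21)
star-inverse α α = refl
star-inverse α β = refl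
star-inverse α γ = refl
star-inverse α δ = refl
star-inverse β α = refl
star-inverse β β = refl
star-inverse β γ = refl
star-inverse β δ = refl
star-inverse γ α = refl
star-inverse γ β = refl
star-inverse γ γ = refl
star-inverse γ δ = refl
star-inverse δ α = refl
star-inverse δ β = refl
star-inverse δ γ = refl
star-inverse δ δ = refl

star-sum : ∀ x → combine one (star ∘ 𝟙) x ≡ 85 * 1
star-sum α = refl
star-sum β = refl
star-sum γ = refl
star-sum δ = refl

-- Functions on letters stored as data, so that the test below evaluates prefix counts only once.
record Quad (A : Set) : Set where
  constructor quad
  field qa qb qc qd : A

tab : ∀ {A : Set} → (Letter → A) → Quad A
tab f = quad (f α) (f β) (f γ) (f δ)

at : ∀ {A : Set} → Quad A → Letter → A
at (quad p q r s) α = p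
at (quad p q r s) β = q
at (quad p q r s) γ = r
at (quad p q r s) δ = s

at-tab : ∀ {A : Set} (f : Letter → A) x → at (tab f) x ≡ f x
at-tab f α = refl
at-tab f β = refl
at-tab f γ = refl
at-tab f δ = refl

-- Exhaustive Boolean tests

allᴸ : (Letter → Bool) → Bool
allᴸ p = p α ∧ p β ∧ p γ ∧ p δ

allᴸ-sound : ∀ p → T (allᴸ p) → ∀ x → T (p x)
allᴸ-sound p h α = proj₁ (Equivalence.to T-∧ h)
allᴸ-sound p h β = proj₁ (Equivalence.to T-∧ (proj₂ (Equivalence.to (T-∧ {p α}) h)))
allᴸ-sound p h γ = proj₁ (Equivalence.to T-∧ (proj₂ (Equivalence.to (T-∧ {p β})
                   (proj₂ (Equivalence.to (T-∧ {p α}) h)))))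
allᴸ-sound p h δ = proj₂ (Equivalence.to (T-∧ {p γ}) (proj₂ (Equivalence.to (T-∧ {p β})
                   (proj₂ (Equivalence.to (T-∧ {p α}) h)))))

all< : ℕ → (ℕ → Bool) → Bool
all< zero    p = true
all< (suc n) p = p n ∧ all< n p

all<-sound : ∀ n p → T (all< n p) → ∀ {i} → i < n → T (p i)
all<-sound (suc n) p h {i} (s≤s i≤n) with Equivalence.to (T-∧ {p n}) h | m≤n⇒m<n∨m≡n i≤n
... | _ , h′ | inj₁ i<n  = all<-sound n p h′ i<n
... | hn , _ | inj₂ refl = hn

anyᴮ : (Bool → Bool) → Bool
anyᴮ p = p false ∨ p true

anyᴮ-sound : ∀ p → T (anyᴮ p) → ∃ λ e → T (p e)
anyᴮ-sound p h with Equivalence.to (T-∨ {p false}) h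
... | inj₁ h′ = false , h′
... | inj₂ h′ = true , h′

-- The finite test for rounding cut points

same : Letter → Letter → Bool
same x y = 𝟙 x y ≡ᵇ 1

bit : Bool → ℕ
bit false = 0
bit true  = 1

-- Rounding with bits e and e′ leads from blocks x and y to the same boundary. This is impossible if
-- the blocks coincide but the letters differ, or if the blocks are adjacent and the letters agree.
clash : Bool → Bool → Letter → Letter → Bool
clash e e′ x y = (e xor e′) xor not (same x y)

Counts : Set
Counts = Quad ℕ

counts : Letter → ℕ → Counts
counts x r = tab λ ℓ → total (image x) (𝟙 ℓ) r

-- Whole blocks have `ν`-weight divisible by 511, so for a cut in a block with letter `x` this is
-- the residue of the whole prefix of `w`.
residue : Letter → ℕ → ℕ
residue x r = total (image x) ν r % 511

Row : Set
Row = Quad (ℕ × Counts)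

row : ℕ → Row
row r = tab λ x → residue x r , counts x r

-- With `m` counting a whole block and `c` its part before the cut, the rounding errors
-- `bit e * m - c` are in balance; the terms are arranged to avoid subtraction.
balancedAt : (m₀ m₁ m₂ c₀ c₁ c₂ : Counts) (e₀ e₁ e₂ : Bool) → Letter → Bool
balancedAt m₀ m₁ m₂ c₀ c₁ c₂ e₀ e₁ e₂ ℓ =
  bit e₀ * at m₀ ℓ + bit e₂ * at m₂ ℓ + 2 * at c₁ ℓ
  ≡ᵇ 2 * (bit e₁ * at m₁ ℓ) + (at c₀ ℓ + at c₂ ℓ)

module _ (r₀ r₁ : ℕ) (x₀ x₁ x₂ : Letter) where

  repaired : (m₀ m₁ m₂ c₀ c₁ c₂ : Counts) (e₀ e₁ e₂ : Bool) → Bool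
  repaired m₀ m₁ m₂ c₀ c₁ c₂ e₀ e₁ e₂ =
    allᴸ (balancedAt m₀ m₁ m₂ c₀ c₁ c₂ e₀ e₁ e₂) ∧
    (clash e₀ e₁ x₀ x₁ ∨ clash e₁ e₂ x₁ x₂ ∨ clash e₀ e₂ x₀ x₂ ∨
     -- Here `i` and `j` lie equally far from their boundaries, so a common boundary gives `i = j`.
     (r₀ + bit e₁ * 85 ≡ᵇ r₁ + bit e₀ * 85))

  test : (m₀ m₁ m₂ c₀ c₁ c₂ : ℕ × Counts) → Bool
  test (_ , m₀) (_ , m₁) (_ , m₂) (ρ₀ , c₀) (ρ₁ , c₁) (ρ₂ , c₂) =
    not ((ρ₀ + ρ₂) % 511 ≡ᵇ (2 * ρ₁) % 511) ∨
    anyᴮ λ e₀ → anyᴮ λ e₁ → anyᴮ (repaired m₀ m₁ m₂ c₀ c₁ c₂ e₀ e₁)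

testEntries : (r₀ r₁ : ℕ) (M R₀ R₁ R₂ : Row) (x₀ x₁ x₂ : Letter) → Bool
testEntries r₀ r₁ M R₀ R₁ R₂ x₀ x₁ x₂ =
  test r₀ r₁ x₀ x₁ x₂ (at M x₀) (at M x₁) (at M x₂) (at R₀ x₀) (at R₁ x₁) (at R₂ x₂)

testRows : (r₀ r₁ : ℕ) (M R₀ R₁ R₂ : Row) → Bool
testRows r₀ r₁ M R₀ R₁ R₂ = allᴸ λ x₀ → allᴸ λ x₁ → allᴸ (testEntries r₀ r₁ M R₀ R₁ R₂ x₀ x₁)

-- The offset of k when i, j, k are equidistant and i, j have offsets r₀, r₁.
third : ℕ → ℕ → ℕ
third r₀ r₁ = (2 * r₁ + (85 ∸ r₀)) % 85

testCell : Row → List Row → ℕ → ℕ → Bool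
testCell z rows r₀ r₁ =
  testRows r₀ r₁ (nth z rows 85) (nth z rows r₀) (nth z rows r₁) (nth z rows (third r₀ r₁))

testAll : Row → List Row → Bool
testAll z rows = all< 85 λ r₀ → all< 85 (testCell z rows r₀)

-- Rows 0 to 84 belong to the possible offsets, and row 85 holds the counts of whole blocks.
tested : testAll (row 0) (applyUpTo row 86) ≡ true
tested = refl

Resolved : (r₀ r₁ : ℕ) (x₀ x₁ x₂ : Letter) (e₀ e₁ e₂ : Bool) → Set
Resolved r₀ r₁ x₀ x₁ x₂ e₀ e₁ e₂ =
  T (clash e₀ e₁ x₀ x₁) ⊎ T (clash e₁ e₂ x₁ x₂) ⊎ T (clash e₀ e₂ x₀ x₂) ⊎
  r₀ + bit e₁ * 85 ≡ r₁ + bit e₀ * 85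

Repair : (r₀ r₁ r₂ : ℕ) (x₀ x₁ x₂ : Letter) (e₀ e₁ e₂ : Bool) → Set
Repair r₀ r₁ r₂ x₀ x₁ x₂ e₀ e₁ e₂ =
  (∀ ℓ → bit e₀ * star (𝟙 ℓ) x₀ + bit e₂ * star (𝟙 ℓ) x₂ + 2 * total (image x₁) (𝟙 ℓ) r₁
         ≡ 2 * (bit e₁ * star (𝟙 ℓ) x₁) + (total (image x₀) (𝟙 ℓ) r₀ + total (image x₂) (𝟙 ℓ) r₂)) ×
  Resolved r₀ r₁ x₀ x₁ x₂ e₀ e₁ e₂

T-not-∨ : ∀ {p q} → T (not p ∨ q) → T p → T q
T-not-∨ {true} h _ = h

resolved : ∀ r₀ r₁ x₀ x₁ x₂ e₀ e₁ e₂ →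
  T (clash e₀ e₁ x₀ x₁ ∨ clash e₁ e₂ x₁ x₂ ∨ clash e₀ e₂ x₀ x₂ ∨
     (r₀ + bit e₁ * 85 ≡ᵇ r₁ + bit e₀ * 85)) → Resolved r₀ r₁ x₀ x₁ x₂ e₀ e₁ e₂
resolved r₀ r₁ x₀ x₁ x₂ e₀ e₁ e₂ h with Equivalence.to (T-∨ {clash e₀ e₁ x₀ x₁}) h
... | inj₁ h₁ = inj₁ h₁
... | inj₂ h₁ with Equivalence.to (T-∨ {clash e₁ e₂ x₁ x₂}) h₁
...   | inj₁ h₂ = inj₂ (inj₁ h₂)
...   | inj₂ h₂ with Equivalence.to (T-∨ {clash e₀ e₂ x₀ x₂}) h₂
...     | inj₁ h₃ = inj₂ (inj₂ (inj₁ h₃))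
...     | inj₂ h₃ = inj₂ (inj₂ (inj₂ (≡ᵇ⇒≡ _ _ h₃)))

test-sound : ∀ r₀ r₁ x₀ x₁ x₂ (m₀ m₁ m₂ c₀ c₁ c₂ : ℕ × Counts) →
  T (test r₀ r₁ x₀ x₁ x₂ m₀ m₁ m₂ c₀ c₁ c₂) →
  (proj₁ c₀ + proj₁ c₂) % 511 ≡ (2 * proj₁ c₁) % 511 →
  ∃ λ e₀ → ∃ λ e₁ → ∃ λ e₂ →
    (∀ ℓ → bit e₀ * at (proj₂ m₀) ℓ + bit e₂ * at (proj₂ m₂) ℓ + 2 * at (proj₂ c₁) ℓ
           ≡ 2 * (bit e₁ * at (proj₂ m₁) ℓ) + (at (proj₂ c₀) ℓ + at (proj₂ c₂) ℓ)) ×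
    Resolved r₀ r₁ x₀ x₁ x₂ e₀ e₁ e₂
test-sound r₀ r₁ x₀ x₁ x₂ (_ , m₀) (_ , m₁) (_ , m₂) (ρ₀ , c₀) (ρ₁ , c₁) (ρ₂ , c₂) h e
  with e₀ , h₀ ← anyᴮ-sound (λ e₀ → anyᴮ λ e₁ → anyᴮ (repaired r₀ r₁ x₀ x₁ x₂ m₀ m₁ m₂ c₀ c₁ c₂ e₀ e₁))
                   (T-not-∨ {(ρ₀ + ρ₂) % 511 ≡ᵇ (2 * ρ₁) % 511} h (≡⇒≡ᵇ _ _ e))
  with e₁ , h₁ ← anyᴮ-sound (λ e₁ → anyᴮ (repaired r₀ r₁ x₀ x₁ x₂ m₀ m₁ m₂ c₀ c₁ c₂ e₀ e₁)) h₀
  with e₂ , h₂ ← anyᴮ-sound (repaired r₀ r₁ x₀ x₁ x₂ m₀ m₁ m₂ c₀ c₁ c₂ e₀ e₁) h₁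
  with h₃ , h₄ ← Equivalence.to (T-∧ {allᴸ (balancedAt m₀ m₁ m₂ c₀ c₁ c₂ e₀ e₁ e₂)}) h₂
  = e₀ , e₁ , e₂ ,
    (λ ℓ → ≡ᵇ⇒≡ _ _ (allᴸ-sound (balancedAt m₀ m₁ m₂ c₀ c₁ c₂ e₀ e₁ e₂) h₃ ℓ)) ,
    resolved r₀ r₁ x₀ x₁ x₂ e₀ e₁ e₂ h₄

testRows-sound : ∀ r₀ r₁ M R₀ R₁ R₂ → T (testRows r₀ r₁ M R₀ R₁ R₂) → ∀ x₀ x₁ x₂ →
  T (testEntries r₀ r₁ M R₀ R₁ R₂ x₀ x₁ x₂)
testRows-sound r₀ r₁ M R₀ R₁ R₂ h x₀ x₁ x₂ =
  allᴸ-sound (t x₀ x₁) (allᴸ-sound (λ x₁ → allᴸ (t x₀ x₁))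
    (allᴸ-sound (λ x₀ → allᴸ λ x₁ → allᴸ (t x₀ x₁)) h x₀) x₁) x₂
  where
  t = testEntries r₀ r₁ M R₀ R₁ R₂

testAll-sound : ∀ z rows → testAll z rows ≡ true → ∀ {r₀ r₁} → r₀ < 85 → r₁ < 85 →
  T (testCell z rows r₀ r₁)
testAll-sound z rows h {r₀} r₀< r₁< = all<-sound 85 (testCell z rows r₀)
  (all<-sound 85 (λ r₀ → all< 85 (testCell z rows r₀)) (subst T (sym h) tt) r₀<) r₁<

-- The table is a variable, tied to its entries by equations, so that the concrete table need not be
-- unfolded in this argument.
repairRow : ∀ z rows → testAll z rows ≡ true → ∀ {r₀ r₁} → r₀ < 85 → r₁ < 85 → ∀ {M R₀ R₁ R₂} →
  nth z rows 85 ≡ M → nth z rows r₀ ≡ R₀ → nth z rows r₁ ≡ R₁ → nth z rows (third r₀ r₁) ≡ R₂ →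
  ∀ x₀ x₁ x₂ →
  (proj₁ (at R₀ x₀) + proj₁ (at R₂ x₂)) % 511 ≡ (2 * proj₁ (at R₁ x₁)) % 511 →
  ∃ λ e₀ → ∃ λ e₁ → ∃ λ e₂ →
    (∀ ℓ → bit e₀ * at (proj₂ (at M x₀)) ℓ + bit e₂ * at (proj₂ (at M x₂)) ℓ
           + 2 * at (proj₂ (at R₁ x₁)) ℓ
           ≡ 2 * (bit e₁ * at (proj₂ (at M x₁)) ℓ)
             + (at (proj₂ (at R₀ x₀)) ℓ + at (proj₂ (at R₂ x₂)) ℓ)) ×
    Resolved r₀ r₁ x₀ x₁ x₂ e₀ e₁ e₂
repairRow z rows h {r₀} {r₁} r₀< r₁< {M} {R₀} {R₁} {R₂} refl refl refl refl x₀ x₁ x₂ =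
  test-sound r₀ r₁ x₀ x₁ x₂ (at M x₀) (at M x₁) (at M x₂) (at R₀ x₀) (at R₁ x₁) (at R₂ x₂)
    (testRows-sound r₀ r₁ M R₀ R₁ R₂ (testAll-sound z rows h r₀< r₁<) x₀ x₁ x₂)

row-entry : ∀ r x → at (row r) x ≡ (residue x r , counts x r)
row-entry r = at-tab λ x → residue x r , counts x r

row-residue : ∀ r x → proj₁ (at (row r) x) ≡ residue x r
row-residue r x = cong proj₁ (row-entry r x)

row-count : ∀ r x ℓ → at (proj₂ (at (row r) x)) ℓ ≡ total (image x) (𝟙 ℓ) r
row-count r x ℓ = trans (cong (λ z → at (proj₂ z) ℓ) (row-entry r x))
                        (at-tab (λ ℓ → total (image x) (𝟙 ℓ) r) ℓ)

repair : ∀ {r₀ r₁ r₂} → r₀ < 85 → r₁ < 85 → third r₀ r₁ ≡ r₂ → ∀ x₀ x₁ x₂ →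
  (residue x₀ r₀ + residue x₂ r₂) % 511 ≡ (2 * residue x₁ r₁) % 511 →
  ∃ λ e₀ → ∃ λ e₁ → ∃ λ e₂ → Repair r₀ r₁ r₂ x₀ x₁ x₂ e₀ e₁ e₂
repair {r₀} {r₁} {r₂} r₀< r₁< refl x₀ x₁ x₂ e =
  let e₀ , e₁ , e₂ , eqs , res = repairRow (row 0) (applyUpTo row 86) tested r₀< r₁<
        (nth-row (n<1+n 85)) (nth-row (m<n⇒m<1+n r₀<)) (nth-row (m<n⇒m<1+n r₁<))
        (nth-row (m<n⇒m<1+n (m%n<n (2 * r₁ + (85 ∸ r₀)) 85))) x₀ x₁ x₂ residues
  in e₀ , e₁ , e₂ , (λ ℓ →
      trans (sym (cong₂ _+_ (cong₂ _+_ (cong (bit e₀ *_) (row-count 85 x₀ ℓ))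
                                       (cong (bit e₂ *_) (row-count 85 x₂ ℓ)))
                            (cong (2 *_) (row-count r₁ x₁ ℓ))))
     (trans (eqs ℓ)
            (cong₂ _+_ (cong (λ z → 2 * (bit e₁ * z)) (row-count 85 x₁ ℓ))
                       (cong₂ _+_ (row-count r₀ x₀ ℓ) (row-count r₂ x₂ ℓ))))) , res
  where
  nth-row : ∀ {r} → r < 86 → nth (row 0) (applyUpTo row 86) r ≡ row r
  nth-row = nth-applyUpTo (row 0) row
  residues : (proj₁ (at (row r₀) x₀) + proj₁ (at (row r₂) x₂)) % 511
             ≡ (2 * proj₁ (at (row r₁) x₁)) % 511
  residues = trans (cong (_% 511) (cong₂ _+_ (row-residue r₀ x₀) (row-residue r₂ x₂)))
            (trans e (cong (λ z → (2 * z) % 511) (sym (row-residue r₁ x₁))))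

-- Descent and abelian square-freeness

AllBalanced : ℕ → ℕ → ℕ → Set
AllBalanced i j k = ∀ ω → Balanced i j k ω

all-balanced : ∀ {i j k} → (∀ ℓ → Balanced i j k (𝟙 ℓ)) → AllBalanced i j k
all-balanced h ω = bal-ext (𝟙-spans ω) (bal-combine ω 𝟙 h)

-- By `star-inverse`, division by 511 leaves the balanced weight `𝟙 m x + 21`. The surplus 21 can be
-- subtracted because constants are balanced: the letter counts of every block add up to 85.
star-injective : ∀ {i j k} → (∀ ℓ → Balanced i j k (star (𝟙 ℓ))) → AllBalanced i j k
star-injective h = all-balanced λ m → bal-+⁻
  (bal-*⁻ 511 (bal-ext (star-inverse m) (bal-combine (λ ℓ → ν (opp m ⊕ ℓ)) (star ∘ 𝟙) h)))
  (bal-* 21 {one} (bal-*⁻ 85 (bal-ext star-sum (bal-combine one (star ∘ 𝟙) h))))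

SquareFreeAt : ℕ → Set
SquareFreeAt j = ∀ i k → AllBalanced i j k → i ≡ j

-- If two adjacent letters are equal, they form a square of half-length 1.
adjacent : ∀ q → SquareFreeAt (suc q) → w q ≢ w (suc q)
adjacent q free e = 1+n≢n (sym (free q (2 + q) λ ω → balanced (begin
  S ω q + (S ω q + ω (w q) + ω (w (suc q)))  ≡⟨ cong (λ x → S ω q + (S ω q + ω (w q) + ω x)) e ⟨
  S ω q + (S ω q + ω (w q) + ω (w q))        ≡⟨ lemma (S ω q) (ω (w q)) ⟩
  2 * (S ω q + ω (w q))                      ∎)))
  where
  open ≡-Reasoning
  lemma : ∀ s t → s + (s + t + t) ≡ 2 * (s + t)
  lemma = solve-∀

same-refl : ∀ x → same x x ≡ true
same-refl α = refl
same-refl β = refl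
same-refl γ = refl
same-refl δ = refl

same-sound : ∀ x y → T (not (not (same x y))) → x ≡ y
same-sound α α _ = refl
same-sound β β _ = refl
same-sound γ γ _ = refl
same-sound δ δ _ = refl

no-clash : ∀ {Q} → SquareFreeAt Q → ∀ e e′ {q q′} → bit e + q ≡ Q → bit e′ + q′ ≡ Q →
           T (clash e e′ (w q) (w q′)) → ⊥
no-clash free false false {q} refl refl h rewrite same-refl (w q) = h
no-clash free true  true  {q} refl refl h rewrite same-refl (w q) = h
no-clash free false true  {q} {q′} refl refl h = adjacent q′ free (sym (same-sound (w q) (w q′) h))
no-clash free true  false {q} {q′} refl refl h = adjacent q free (same-sound (w q) (w q′) h)

S-shift : ∀ ω e q → S ω (bit e + q) ≡ S ω q + bit e * ω (w q)
S-shift ω false q = sym (+-identityʳ _)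
S-shift ω true  q = cong (S ω q +_) (sym (*-identityˡ _))

-- Rounding up sends 1 to 1, so the descent is strict only from 2 on; `w-squareFree` treats 0 and 1
-- apart.
shifted< : ∀ e r q → 2 ≤ r + q * 85 → bit e + q < r + q * 85
shifted< false r zero    h = ≤-trans (s≤s z≤n) h
shifted< true  r zero    h = h
shifted< e     r (suc q) h = ≤-trans (+-mono-≤ (bit≤1 e) (s≤s (m≤m*n q 85))) bound
  where
  bit≤1 : ∀ e → suc (bit e) ≤ 2
  bit≤1 false = s≤s z≤n
  bit≤1 true  = ≤-refl
  bound : 2 + (1 + q * 85) ≤ r + (85 + q * 85)
  bound = ≤-trans (m≤n+m (3 + q * 85) r) (+-monoʳ-≤ r (+-monoˡ-≤ (q * 85) {3} {85} (≤ᵇ⇒≤ 3 85 _)))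

module Descent (q₀ q₁ q₂ : ℕ) {r₀ r₁ r₂ : ℕ} (r₀< : r₀ < 85) (r₁< : r₁ < 85) (r₂< : r₂ < 85)
               (H : AllBalanced (r₀ + q₀ * 85) (r₁ + q₁ * 85) (r₂ + q₂ * 85)) where

  t₀ t₁ t₂ : Weight → ℕ
  t₀ ω = total (image (w q₀)) ω r₀
  t₁ ω = total (image (w q₁)) ω r₁
  t₂ ω = total (image (w q₂)) ω r₂

  blocks : ∀ ω → S (star ω) q₀ + t₀ ω + (S (star ω) q₂ + t₂ ω) ≡ 2 * (S (star ω) q₁ + t₁ ω)
  blocks ω = begin
    S (star ω) q₀ + t₀ ω + (S (star ω) q₂ + t₂ ω)  ≡⟨ cong₂ _+_ (S-block ω q₀ r₀ (<⇒≤ r₀<)) (S-block ω q₂ r₂ (<⇒≤ r₂<)) ⟨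
    S ω (r₀ + q₀ * 85) + S ω (r₂ + q₂ * 85)        ≡⟨ sums (H ω) ⟩
    2 * S ω (r₁ + q₁ * 85)                         ≡⟨ cong (2 *_) (S-block ω q₁ r₁ (<⇒≤ r₁<)) ⟩
    2 * (S (star ω) q₁ + t₁ ω)                     ∎
    where open ≡-Reasoning

  third-r₂ : third r₀ r₁ ≡ r₂
  third-r₂ = begin
    (2 * r₁ + (85 ∸ r₀)) % 85                      ≡⟨ [m+kn]%n≡m%n (2 * r₁ + (85 ∸ r₀)) (2 * q₁) 85 ⟨
    (2 * r₁ + (85 ∸ r₀) + 2 * q₁ * 85) % 85        ≡⟨ cong (_% 85) same-sum ⟩
    (r₂ + (1 + q₀ + q₂) * 85) % 85                 ≡⟨ [r+q*k]%k≡r (1 + q₀ + q₂) r₂< ⟩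
    r₂                                             ∎
    where
    open ≡-Reasoning
    lengths : r₀ + q₀ * 85 + (r₂ + q₂ * 85) ≡ 2 * (r₁ + q₁ * 85)
    lengths = trans (sym (cong₂ _+_ (S-one (r₀ + q₀ * 85)) (S-one (r₂ + q₂ * 85))))
             (trans (sums (H one)) (cong (2 *_) (S-one (r₁ + q₁ * 85))))
    l₁ : ∀ r₀ r₁ q₁ s m → r₀ + (2 * r₁ + s + 2 * q₁ * m) ≡ 2 * (r₁ + q₁ * m) + (r₀ + s)
    l₁ = solve-∀
    l₂ : ∀ r₀ r₂ q₀ q₂ m → r₀ + q₀ * m + (r₂ + q₂ * m) + m ≡ r₀ + (r₂ + (1 + q₀ + q₂) * m)
    l₂ = solve-∀
    same-sum : 2 * r₁ + (85 ∸ r₀) + 2 * q₁ * 85 ≡ r₂ + (1 + q₀ + q₂) * 85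
    -- Adding `r₀` turns the truncated difference `85 ∸ r₀` into 85.
    same-sum = +-cancelˡ-≡ r₀ _ _ (trans (l₁ r₀ r₁ q₁ (85 ∸ r₀) 85)
      (trans (cong₂ _+_ (sym lengths) (m+[n∸m]≡n (<⇒≤ r₀<))) (l₂ r₀ r₂ q₀ q₂ 85)))

  residues : (residue (w q₀) r₀ + residue (w q₂) r₂) % 511 ≡ (2 * residue (w q₁) r₁) % 511
  residues = begin
    (t₀ ν % 511 + t₂ ν % 511) % 511                ≡⟨ %-distribˡ-+ (t₀ ν) (t₂ ν) 511 ⟨
    (t₀ ν + t₂ ν) % 511                            ≡⟨ [m+kn]%n≡m%n (t₀ ν + t₂ ν) (κ q₀ + κ q₂) 511 ⟨
    (t₀ ν + t₂ ν + (κ q₀ + κ q₂) * 511) % 511      ≡⟨ cong (_% 511) totals ⟩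
    (2 * t₁ ν + 2 * κ q₁ * 511) % 511              ≡⟨ [m+kn]%n≡m%n (2 * t₁ ν) (2 * κ q₁) 511 ⟩
    (2 * t₁ ν) % 511                               ≡⟨ %-distribˡ-* 2 (t₁ ν) 511 ⟩
    (2 * (t₁ ν % 511)) % 511                       ∎
    where
    open ≡-Reasoning
    κ : ℕ → ℕ
    κ = S λ x → 𝟙 α x + 21
    κ-spec : ∀ q → S (star ν) q ≡ 511 * κ q
    κ-spec q = trans (S-ext star-ν q) (S-* 511 (λ x → 𝟙 α x + 21) q)
    l₁ : ∀ t t′ k k′ m → t + t′ + (k + k′) * m ≡ m * k + t + (m * k′ + t′)
    l₁ = solve-∀
    l₂ : ∀ t k m → 2 * (m * k + t) ≡ 2 * t + 2 * k * m
    l₂ = solve-∀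
    totals : t₀ ν + t₂ ν + (κ q₀ + κ q₂) * 511 ≡ 2 * t₁ ν + 2 * κ q₁ * 511
    totals = trans (l₁ (t₀ ν) (t₂ ν) (κ q₀) (κ q₂) 511)
          (trans (sym (cong₂ (λ x y → x + t₀ ν + (y + t₂ ν)) (κ-spec q₀) (κ-spec q₂)))
          (trans (blocks ν)
          (trans (cong (λ x → 2 * (x + t₁ ν)) (κ-spec q₁)) (l₂ (t₁ ν) (κ q₁) 511))))

  -- Adding the balance of the rounding errors to that of the cuts cancels the partial blocks; what
  -- remains concerns whole blocks, where `star-injective` applies.
  descend : ∀ {e₀ e₁ e₂} → Repair r₀ r₁ r₂ (w q₀) (w q₁) (w q₂) e₀ e₁ e₂ →
            AllBalanced (bit e₀ + q₀) (bit e₁ + q₁) (bit e₂ + q₂)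
  descend {e₀} {e₁} {e₂} (eqs , _) = star-injective λ ℓ →
    let ω = star (𝟙 ℓ)
        u₀ = bit e₀ * ω (w q₀)
        u₁ = bit e₁ * ω (w q₁)
        u₂ = bit e₂ * ω (w q₂)
        y₀ = t₀ (𝟙 ℓ)
        y₁ = t₁ (𝟙 ℓ)
        y₂ = t₂ (𝟙 ℓ)
    in balanced (trans (cong₂ _+_ (S-shift ω e₀ q₀) (S-shift ω e₂ q₂))
      (trans (+-cancelʳ-≡ (y₀ + y₂ + 2 * y₁) _ _
                (trans (l₁ (S ω q₀) (S ω q₂) u₀ u₂ y₀ y₁ y₂)
                (trans (cong₂ _+_ (blocks (𝟙 ℓ)) (eqs ℓ))
                       (l₂ (S ω q₁) u₁ y₀ y₁ y₂))))
             (cong (2 *_) (sym (S-shift ω e₁ q₁)))))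
    where
    l₁ : ∀ s₀ s₂ u₀ u₂ y₀ y₁ y₂ → s₀ + u₀ + (s₂ + u₂) + (y₀ + y₂ + 2 * y₁)
                                  ≡ s₀ + y₀ + (s₂ + y₂) + (u₀ + u₂ + 2 * y₁)
    l₁ = solve-∀
    l₂ : ∀ s₁ u₁ y₀ y₁ y₂ → 2 * (s₁ + y₁) + (2 * u₁ + (y₀ + y₂))
                            ≡ 2 * (s₁ + u₁) + (y₀ + y₂ + 2 * y₁)
    l₂ = solve-∀

  module _ (rec : ∀ {j} → j < r₁ + q₁ * 85 → SquareFreeAt j) (2≤ : 2 ≤ r₁ + q₁ * 85) where

    conclude : ∀ e₀ e₁ e₂ → Repair r₀ r₁ r₂ (w q₀) (w q₁) (w q₂) e₀ e₁ e₂ →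
               r₀ + q₀ * 85 ≡ r₁ + q₁ * 85
    conclude e₀ e₁ e₂ rep = cases (proj₂ rep)
      where
      free : SquareFreeAt (bit e₁ + q₁)
      free = rec (shifted< e₁ r₁ q₁ 2≤)
      bal : AllBalanced (bit e₀ + q₀) (bit e₁ + q₁) (bit e₂ + q₂)
      bal = descend {e₀} {e₁} {e₂} rep
      eq₀ : bit e₀ + q₀ ≡ bit e₁ + q₁
      eq₀ = free _ _ bal
      eq₂ : bit e₂ + q₂ ≡ bit e₁ + q₁
      -- The triple read backwards is balanced too, so its far end also meets the middle.
      eq₂ = free (bit e₂ + q₂) (bit e₀ + q₀) λ ω →
        balanced (trans (+-comm (S ω (bit e₂ + q₂)) (S ω (bit e₀ + q₀))) (sums (bal ω)))
      l₁ : ∀ r q x y m → r + q * m + (x + y) * m ≡ (r + y * m) + (x + q) * m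
      l₁ = solve-∀
      l₂ : ∀ r q x y m → r + x * m + (y + q) * m ≡ r + q * m + (x + y) * m
      l₂ = solve-∀
      cases : Resolved r₀ r₁ (w q₀) (w q₁) (w q₂) e₀ e₁ e₂ → r₀ + q₀ * 85 ≡ r₁ + q₁ * 85
      cases (inj₁ h)               = ⊥-elim (no-clash free e₀ e₁ eq₀ refl h)
      cases (inj₂ (inj₁ h))        = ⊥-elim (no-clash free e₁ e₂ refl eq₂ h)
      cases (inj₂ (inj₂ (inj₁ h))) = ⊥-elim (no-clash free e₀ e₂ eq₀ eq₂ h)
      cases (inj₂ (inj₂ (inj₂ h))) = +-cancelʳ-≡ ((bit e₀ + bit e₁) * 85) _ _
        (trans (l₁ r₀ q₀ (bit e₀) (bit e₁) 85)
        (trans (cong₂ (λ x y → x + y * 85) h eq₀) (l₂ r₁ q₁ (bit e₀) (bit e₁) 85)))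

    aligned : r₀ + q₀ * 85 ≡ r₁ + q₁ * 85
    aligned = let e₀ , e₁ , e₂ , rep = repair r₀< r₁< third-r₂ (w q₀) (w q₁) (w q₂) residues
              in conclude e₀ e₁ e₂ rep

-- The word begins with the different letters `α`, `β`, so counting `α` excludes a square there.
sum≡2 : ∀ i k → i + k ≡ 2 → AllBalanced i 1 k → i ≡ 1
sum≡2 0 .2 refl H with () ← sums (H (𝟙 α))
sum≡2 1 .1 refl H = refl
sum≡2 2 .0 refl H with () ← sums (H (𝟙 α))

w-squareFree : ∀ j → SquareFreeAt j
w-squareFree = <-rec SquareFreeAt go
  where
  digit : ∀ n → n ≡ n % 85 + n / 85 * 85
  digit n = m≡m%n+[m/n]*n n 85
  lengths : ∀ i j k → AllBalanced i j k → i + k ≡ 2 * j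
  lengths i j k H = trans (sym (cong₂ _+_ (S-one i) (S-one k))) (trans (sums (H one)) (cong (2 *_) (S-one j)))
  go : ∀ j → (∀ {j′} → j′ < j → SquareFreeAt j′) → SquareFreeAt j
  go 0 rec i k H = m+n≡0⇒m≡0 i (lengths i 0 k H)
  go 1 rec i k H = sum≡2 i k (lengths i 1 k H) H
  go j@(suc (suc _)) rec i k H = trans (digit i) (trans
    (Descent.aligned (i / 85) (j / 85) (k / 85) (m%n<n i 85) (m%n<n j 85) (m%n<n k 85)
      (subst₂ (λ i′ k′ → AllBalanced i′ (j % 85 + j / 85 * 85) k′) (digit i) (digit k)
        (subst (λ j′ → AllBalanced i j′ k) (digit j) H))
      (λ {j′} j′< → rec (subst (j′ <_) (sym (digit j)) j′<))
      (subst (2 ≤_) (digit j) (s≤s (s≤s z≤n))))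
    (sym (digit j)))

-- Paths in a tree

⋖-parent : ∀ {t} {p q r : Pos t} → p ⋖ r → q ⋖ r → p ≡ q
⋖-parent (root i)   (root .i)   = refl
⋖-parent (step i x) (step .i y) = cong (there i) (⋖-parent x y)

-- A duplicate-free path that starts with a downward step keeps going down, since going back up
-- would revisit the parent.
descending : ∀ {t} {p q : Pos t} {rs} → p ⋖ q → Unique (p ∷ q ∷ rs) → Linked Adj (q ∷ rs) →
             Linked _⋖_ (p ∷ q ∷ rs)
descending p⋖q uniq [-] = p⋖q ∷ [-]
descending p⋖q (_ ∷ uniq) (inj₁ q⋖r ∷ adj) = p⋖q ∷ descending q⋖r uniq adj
descending p⋖q ((_ ∷ p≢r ∷ _) ∷ _) (inj₂ r⋖q ∷ _) = ⊥-elim (p≢r (⋖-parent p⋖q r⋖q))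

descending-here : ∀ {t} {ps : List (Pos t)} → IsPath (here ∷ ps) → Linked _⋖_ (here ∷ ps)
descending-here (_ , [-])                  = [-]
descending-here (uniq , inj₁ here⋖ ∷ adj)  = descending here⋖ uniq adj

module _ {A : Set} {R : A → A → Set} where

  linked-suffix : ∀ xs {ys} → Linked R (xs ++ ys) → Linked R ys
  linked-suffix []       l = l
  linked-suffix (x ∷ xs) l = linked-suffix xs (Linked.tail l)

  linked-prefix : ∀ x xs {ys} → Linked R (x ∷ xs ++ ys) → Linked R (x ∷ xs)
  linked-prefix x []       l       = [-]
  linked-prefix x (y ∷ xs) (r ∷ l) = r ∷ linked-prefix y xs l

  linked-reverseAcc : Symmetric R → ∀ {x acc} xs → Linked R (x ∷ acc) → Linked R (x ∷ xs) →
                      Linked R (reverseAcc (x ∷ acc) xs)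
  linked-reverseAcc s []       la l       = la
  linked-reverseAcc s (y ∷ xs) la (r ∷ l) = linked-reverseAcc s xs (s r ∷ la) l

  linked-reverse : Symmetric R → ∀ {xs} → Linked R xs → Linked R (reverse xs)
  linked-reverse s {[]}     l = []
  linked-reverse s {x ∷ xs} l = linked-reverseAcc s xs [-] l

unique-suffix : ∀ {A : Set} (xs : List A) {ys} → Unique (xs ++ ys) → Unique ys
unique-suffix []       u       = u
unique-suffix (x ∷ xs) (_ ∷ u) = unique-suffix xs u

unique-apart : ∀ {A : Set} (xs : List A) {ys} → Unique (xs ++ ys) → All (λ x → All (x ≢_) ys) xs
unique-apart []       u       = []
unique-apart (x ∷ xs) (a ∷ u) = All.++⁻ʳ xs a ∷ unique-apart xs u

unique-reverse : ∀ {A : Set} {xs : List A} → Unique xs → Unique (reverse xs)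
unique-reverse {A} {xs} = Unique-resp-↭ (setoid A) (↭⇒↭ₛ (↭-sym (↭-reverse xs)))

isPath-suffix : ∀ {t} (ps : List (Pos t)) {qs} → IsPath (ps ++ qs) → IsPath qs
isPath-suffix ps (u , l) = unique-suffix ps u , linked-suffix ps l

isPath-reverse : ∀ {t} {ps : List (Pos t)} → IsPath ps → IsPath (reverse ps)
isPath-reverse (u , l) = unique-reverse u , linked-reverse swap l

reverse-around : ∀ {A : Set} (xs : List A) y zs → reverse (xs ++ y ∷ zs) ≡ reverse zs ++ y ∷ reverse xs
reverse-around xs y zs = begin
  reverse (xs ++ y ∷ zs)                  ≡⟨ reverse-++ xs (y ∷ zs) ⟩
  reverse (y ∷ zs) ++ reverse xs          ≡⟨ cong (_++ reverse xs) (unfold-reverse y zs) ⟩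
  (reverse zs ++ y ∷ []) ++ reverse xs    ≡⟨ ++-assoc (reverse zs) (y ∷ []) (reverse xs) ⟩
  reverse zs ++ y ∷ reverse xs            ∎
  where open ≡-Reasoning

end : ∀ {A : Set} → A → List A → A
end x []       = x
end x (y ∷ ys) = end y ys

end-there : ∀ {ts} i {p : Pos (lookup ts i)} {qs : List (Pos (node ts))} →
            Linked _⋖_ (there i p ∷ qs) → ∃ λ q → end (there i p) qs ≡ there i q
end-there i {p} [-]            = p , refl
end-there i     (step .i _ ∷ l) = end-there i l

locate : ∀ {t} (ps : List (Pos t)) → (∃₂ λ us vs → ps ≡ us ++ here ∷ vs) ⊎ All (_≢ here) ps
locate []               = inj₂ []
locate (here ∷ ps)      = inj₁ ([] , ps , refl)
locate (there i p ∷ ps) with locate ps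
... | inj₁ (us , vs , refl) = inj₁ (there i p ∷ us , vs , refl)
... | inj₂ avoids           = inj₂ ((λ ()) ∷ avoids)

-- Different child subtrees are connected only through `here`.
stays : ∀ {ts} i {p : Pos (lookup ts i)} {ps : List (Pos (node ts))} →
        Linked Adj (there i p ∷ ps) → All (_≢ here) ps → ∃ λ qs → ps ≡ map (there i) qs
stays i [-] _ = [] , refl
stays i {ps = here ∷ _} _ (≢here ∷ _) = ⊥-elim (≢here refl)
stays i {ps = there .i q ∷ _} (inj₁ (step .i _) ∷ l) (_ ∷ a) with qs , refl ← stays i l a = q ∷ qs , refl
stays i {ps = there .i q ∷ _} (inj₂ (step .i _) ∷ l) (_ ∷ a) with qs , refl ← stays i l a = q ∷ qs , refl

adj-there⁻ : ∀ {ts} i {p q : Pos (lookup ts i)} → Adj (there {ts} i p) (there i q) → Adj p q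
adj-there⁻ i (inj₁ (step .i x)) = inj₁ x
adj-there⁻ i (inj₂ (step .i x)) = inj₂ x

isPath-there⁻ : ∀ {ts} i {ps : List (Pos (lookup ts i))} → IsPath (map (there {ts} i) ps) → IsPath ps
isPath-there⁻ i (u , l) = Unique.map⁻ u , Linked.map (adj-there⁻ i) (Linked.map⁻ l)

split-map : ∀ {A B : Set} (f : A → B) xs {ys zs} → map f xs ≡ ys ++ zs →
            ∃₂ λ us vs → xs ≡ us ++ vs × map f us ≡ ys × map f vs ≡ zs
split-map f xs {[]} e = [] , xs , refl , refl , e
split-map f (x ∷ xs) {y ∷ ys} e with us , vs , refl , refl , refl ← split-map f xs {ys} (∷-injectiveʳ e)
  = x ∷ us , vs , refl , cong (_∷ map f us) (∷-injectiveˡ e) , refl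

-- The three ends of an up-down path with apex here: u ends the part before here, v the part
-- after it, and m is the last vertex of the half that contains here.
data Fork {ts} : (u m v : Pos (node ts)) → Set where
  vertical : ∀ {m v} → Fork here m v
  fork     : ∀ {i j p m q} → i ≢ j → m ≡ here ⊎ (∃ λ m′ → m ≡ there j m′) →
             Fork (there i p) m (there j q)

-- Both arms begin with a child of `here`; the path repeats no vertex, so these children differ.
forks : ∀ {ts} {rs} (vs₁ {vs₂} : List (Pos (node ts))) →
        Linked _⋖_ (here ∷ rs) → Linked _⋖_ (here ∷ vs₁ ++ vs₂) →
        All (λ x → All (x ≢_) (here ∷ vs₁ ++ vs₂)) rs → vs₂ ≢ [] →
        Fork (end here rs) (end here vs₁) (end here (vs₁ ++ vs₂))
forks vs₁ [-] _ _ _ = vertical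
forks [] {[]} (_ ∷ _) _ _ ≢[] = ⊥-elim (≢[] refl)
forks [] {v ∷ vs} (root i ∷ up) (root j ∷ down) ((_ ∷ ≢v ∷ _) ∷ _) _
  with p , e ← end-there i up | q , e′ ← end-there j down rewrite e | e′
  = fork (λ { refl → ≢v refl }) (inj₁ refl)
forks (v ∷ vs₁) {vs₂} (root i ∷ up) (root j ∷ down) ((_ ∷ ≢v ∷ _) ∷ _) _
  with p , e ← end-there i up | q , e′ ← end-there j down | end-there j (linked-prefix v vs₁ down)
... | m rewrite e | e′ = fork (λ { refl → ≢v refl }) (inj₂ m)

-- Anagrams as equations between weights

module Weighted {C : Set} where

  Free : ∀ {t} → (Pos t → C) → Set
  Free κ = ∀ ps → IsPath ps → ¬ Anagram (map κ ps)

  wt : ∀ {t} → (C → ℕ) → (Pos t → C) → Pos t → ℕ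
  wt ω κ here        = ω (κ here)
  wt ω κ (there i p) = ω (κ here) + wt ω (κ ∘ there i) p

  wt-⋖ : ∀ {t} ω (κ : Pos t → C) {p q} → p ⋖ q → wt ω κ q ≡ wt ω κ p + ω (κ q)
  wt-⋖ ω κ (root i)   = refl
  wt-⋖ ω κ (step i l) = trans (cong (ω (κ here) +_) (wt-⋖ ω (κ ∘ there i) l)) (sym (+-assoc (ω (κ here)) _ _))

  weigh : (C → ℕ) → List C → ℕ
  weigh ω xs = sum (map ω xs)

  weigh-↭ : ∀ ω {xs ys} → xs ↭ ys → weigh ω xs ≡ weigh ω ys
  weigh-↭ ω p = sum-↭ (↭-map⁺ ω p)

  weigh-++ : ∀ ω xs ys → weigh ω (xs ++ ys) ≡ weigh ω xs + weigh ω ys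
  weigh-++ ω xs ys = trans (cong sum (map-++ ω xs ys)) (sum-++ (map ω xs) (map ω ys))

  wt-end : ∀ {t} ω (κ : Pos t → C) {p ps} → Linked _⋖_ (p ∷ ps) →
           wt ω κ (end p ps) ≡ wt ω κ p + weigh ω (map κ ps)
  wt-end ω κ [-] = sym (+-identityʳ _)
  wt-end ω κ {p} (l ∷ ls) = trans (wt-end ω κ ls)
    (trans (cong (_+ _) (wt-⋖ ω κ l)) (+-assoc (wt ω κ p) _ _))

  module _ {ts} (κ : Pos (node ts) → C) where

    -- The half containing `here` weighs `wt u + wt m - ω (κ here)`, the other `wt v - wt m`; this
    -- equates the two without subtraction.
    Even : (u m v : Pos (node ts)) → Set
    Even u m v = ∀ ω → wt ω κ u + 2 * wt ω κ m ≡ wt ω κ v + ω (κ here)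

    EvenFork : Set
    EvenFork = ∃ λ u → ∃ λ m → ∃ λ v → Fork u m v × Even u m v

    apex : ∀ us vs₁ vs₂ → IsPath (us ++ here ∷ vs₁ ++ vs₂) →
           (∀ ω → weigh ω (map κ us) + (ω (κ here) + weigh ω (map κ vs₁)) ≡ weigh ω (map κ vs₂)) →
           EvenFork
    apex us vs₁ vs₂ path eq = end here (reverse us) , end here vs₁ , end here (vs₁ ++ vs₂) ,
      forks vs₁ up down (All-resp-↭ (↭-sym (↭-reverse us)) (unique-apart us (proj₁ path))) nonempty , even
      where
      up : Linked _⋖_ (here ∷ reverse us)
      up = descending-here (isPath-suffix (reverse (vs₁ ++ vs₂))
             (subst IsPath (reverse-around us here (vs₁ ++ vs₂)) (isPath-reverse path)))
      down : Linked _⋖_ (here ∷ vs₁ ++ vs₂)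
      down = descending-here (isPath-suffix us path)
      nonempty : vs₂ ≢ []
      nonempty refl with () ← m+n≡0⇒n≡0 (weigh (λ _ → 1) (map κ us)) (eq (λ _ → 1))
      lemma : ∀ o s t → o + s + 2 * (o + t) ≡ o + (t + (s + (o + t))) + o
      lemma = solve-∀
      even : Even (end here (reverse us)) (end here vs₁) (end here (vs₁ ++ vs₂))
      even ω = begin
        wt ω κ (end here (reverse us)) + 2 * wt ω κ (end here vs₁)
          ≡⟨ cong₂ (λ x y → x + 2 * y) (wt-end ω κ up) (wt-end ω κ (linked-prefix here vs₁ down)) ⟩
        o + weigh ω (map κ (reverse us)) + 2 * (o + weigh ω (map κ vs₁))
          ≡⟨ cong (λ x → o + x + 2 * (o + weigh ω (map κ vs₁))) (weigh-↭ ω (↭-map⁺ κ (↭-reverse us))) ⟩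
        o + weigh ω (map κ us) + 2 * (o + weigh ω (map κ vs₁))
          ≡⟨ lemma o (weigh ω (map κ us)) (weigh ω (map κ vs₁)) ⟩
        o + (weigh ω (map κ vs₁) + (weigh ω (map κ us) + (o + weigh ω (map κ vs₁)))) + o
          ≡⟨ cong (λ x → o + (weigh ω (map κ vs₁) + x) + o) (eq ω) ⟩
        o + (weigh ω (map κ vs₁) + weigh ω (map κ vs₂)) + o
          ≡⟨ cong (λ x → o + x + o) (weigh-++ ω (map κ vs₁) (map κ vs₂)) ⟨
        o + weigh ω (map κ vs₁ ++ map κ vs₂) + o
          ≡⟨ cong (λ x → o + weigh ω x + o) (map-++ κ vs₁ vs₂) ⟨
        o + weigh ω (map κ (vs₁ ++ vs₂)) + o
          ≡⟨ cong (_+ o) (wt-end ω κ down) ⟨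
        wt ω κ (end here (vs₁ ++ vs₂)) + o  ∎
        where
        open ≡-Reasoning
        o = ω (κ here)

    weigh-around : ∀ ω us vs → weigh ω (map κ (us ++ here ∷ vs)) ≡
                               weigh ω (map κ us) + (ω (κ here) + weigh ω (map κ vs))
    weigh-around ω us vs = trans (cong (weigh ω) (map-++ κ us (here ∷ vs)))
                                 (weigh-++ ω (map κ us) (κ here ∷ map κ vs))

    weigh-reverse : ∀ ω ps → weigh ω (map κ (reverse ps)) ≡ weigh ω (map κ ps)
    weigh-reverse ω ps = weigh-↭ ω (↭-map⁺ κ (↭-reverse ps))

    -- If here lies in the second half, the reversed path has it in the first half.
    anagram-through-here : ∀ xs ys → IsPath (xs ++ ys) → map κ ys ↭ map κ xs →
                           EvenFork ⊎ All (_≢ here) (xs ++ ys)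
    anagram-through-here xs ys path perm with locate xs | locate ys
    ... | inj₁ (us , vs , refl) | _ = inj₁ (apex us vs ys (subst IsPath (++-assoc us (here ∷ vs) ys) path)
      λ ω → trans (sym (weigh-around ω us vs)) (sym (weigh-↭ ω perm)))
    ... | inj₂ _ | inj₁ (us , vs , refl) = inj₁ (apex (reverse vs) (reverse us) (reverse xs) (subst IsPath
        (trans (reverse-++ xs (us ++ here ∷ vs)) (trans (cong (_++ reverse xs) (reverse-around us here vs))
               (++-assoc (reverse vs) (here ∷ reverse us) (reverse xs))))
        (isPath-reverse path))
      λ ω → begin
        weigh ω (map κ (reverse vs)) + (ω (κ here) + weigh ω (map κ (reverse us)))
          ≡⟨ weigh-around ω (reverse vs) (reverse us) ⟨
        weigh ω (map κ (reverse vs ++ here ∷ reverse us))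
          ≡⟨ cong (λ z → weigh ω (map κ z)) (reverse-around us here vs) ⟨
        weigh ω (map κ (reverse (us ++ here ∷ vs)))
          ≡⟨ weigh-reverse ω (us ++ here ∷ vs) ⟩
        weigh ω (map κ (us ++ here ∷ vs))
          ≡⟨ weigh-↭ ω perm ⟩
        weigh ω (map κ xs)
          ≡⟨ weigh-reverse ω xs ⟨
        weigh ω (map κ (reverse xs))  ∎)
      where open ≡-Reasoning
    ... | inj₂ avoids₁ | inj₂ avoids₂ = inj₂ (All.++⁺ avoids₁ avoids₂)

    -- An anagram through the root gives an even fork; any other path stays within one child
    -- subtree, which is free.
    free-node : (∀ i → Free (κ ∘ there i)) → (∀ {u m v} → Fork u m v → Even u m v → ⊥) → Free κ
    free-node free ¬even ps path anagram@(W , P , W≢[] , P↭W , e)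
      with xs , ys , refl , refl , refl ← split-map κ ps {W} {P} e
      with anagram-through-here xs ys path P↭W
    ... | inj₁ (_ , _ , _ , f , even) = ¬even f even
    ... | inj₂ avoids = within (xs ++ ys) path avoids anagram
      where
      within : ∀ ps → IsPath ps → All (_≢ here) ps → Anagram (map κ ps) → ⊥
      within []               _          _             ([] , _ , W≢[] , _) = W≢[] refl
      within (here ∷ _)       _          (≢here ∷ _)   _ = ≢here refl
      within (there i p ∷ ps) path       (_ ∷ avoids)  anagram
        with qs , refl ← stays i (proj₂ path) avoids =
        free i (p ∷ qs) (isPath-there⁻ i path) (subst Anagram (sym (map-∘ (p ∷ qs))) anagram)

open Weighted

-- The subdivision and its colouring

data Colour : Set where
  original    : Colour
  upper lower : Letter → Colour

Colouring : Tree → Set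
Colouring t = Pos t → Colour

originals uppers lowers divisions : Colour → ℕ
originals original  = 1
originals (upper _) = 0
originals (lower _) = 0
uppers original  = 0
uppers (upper _) = 1
uppers (lower _) = 0
lowers original  = 0
lowers (upper _) = 0
lowers (lower _) = 1
divisions original  = 0
divisions (upper _) = 1
divisions (lower _) = 1

onLetters : Weight → Colour → ℕ
onLetters ω original  = 0
onLetters ω (upper ℓ) = ω ℓ
onLetters ω (lower ℓ) = ω ℓ

-- The division vertices on each downward path from the root spell w from position o on.
record Reads {t} (o : ℕ) (κ : Colouring t) : Set where
  constructor reading
  field read : ∀ ω v → S ω o + wt (onLetters ω) κ v ≡ S ω (o + wt divisions κ v)

open Reads

-- On a downward path evenness yields a balanced triple of `w` that starts at `o`, so
-- square-freeness makes its first factor empty.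
vertical-square : ∀ {t o} {κ : Colouring t} → Reads o κ → ∀ m v →
                  (∀ ω → ω (κ here) + 2 * wt ω κ m ≡ wt ω κ v + ω (κ here)) → wt divisions κ m ≡ 0
vertical-square {o = o} {κ} reads m v even = sym (+-cancelˡ-≡ o _ _ (trans (+-identityʳ o)
  (w-squareFree (o + wt divisions κ m) o (o + wt divisions κ v) λ ω → balanced (begin
    S ω o + S ω (o + wt divisions κ v)      ≡⟨ cong (S ω o +_) (read reads ω v) ⟨
    S ω o + (S ω o + W ω v)                 ≡⟨ cong (λ x → S ω o + (S ω o + x)) (twice ω) ⟨
    S ω o + (S ω o + 2 * W ω m)             ≡⟨ lemma (S ω o) (W ω m) ⟩
    2 * (S ω o + W ω m)                     ≡⟨ cong (2 *_) (read reads ω m) ⟩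
    2 * S ω (o + wt divisions κ m)          ∎))))
  where
  open ≡-Reasoning
  W : Weight → Pos _ → ℕ
  W ω = wt (onLetters ω) κ
  twice : ∀ ω → 2 * W ω m ≡ W ω v
  twice ω = +-cancelˡ-≡ (onLetters ω (κ here)) _ _
              (trans (even (onLetters ω)) (+-comm (W ω v) (onLetters ω (κ here))))
  lemma : ∀ s t → s + (s + 2 * t) ≡ 2 * (s + t)
  lemma = solve-∀

above : ∀ {s} → Colour → Colouring s → Colouring (node (s ∷ []))
above x κ here           = x
above x κ (there zero p) = κ p

reads-above : ∀ {s o x} {κ : Colouring s} → (∀ ω → onLetters ω x ≡ ω (w o)) → divisions x ≡ 1 →
              Reads (suc o) κ → Reads o (above x κ)
reads-above {o = o} {x} {κ} letter one reads = reading go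
  where
  open ≡-Reasoning
  go : ∀ ω v → S ω o + wt (onLetters ω) (above x κ) v ≡ S ω (o + wt divisions (above x κ) v)
  go ω here =
    trans (cong (S ω o +_) (letter ω)) (cong (S ω) (sym (trans (cong (o +_) one) (+-comm o 1))))
  go ω (there zero p) = begin
    S ω o + (onLetters ω x + wt (onLetters ω) κ p)   ≡⟨ cong (λ y → S ω o + (y + wt (onLetters ω) κ p)) (letter ω) ⟩
    S ω o + (ω (w o) + wt (onLetters ω) κ p)         ≡⟨ +-assoc (S ω o) _ _ ⟨
    S ω (suc o) + wt (onLetters ω) κ p               ≡⟨ read reads ω p ⟩
    S ω (suc o + wt divisions κ p)                   ≡⟨ cong (S ω) (+-suc o _) ⟨
    S ω (o + (1 + wt divisions κ p))                 ≡⟨ cong (λ y → S ω (o + (y + wt divisions κ p))) one ⟨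
    S ω (o + (divisions x + wt divisions κ p))       ∎

-- With a single child no path turns at the root, and on a vertical one the root itself is a
-- division vertex in the first half.
free-above : ∀ {s o x} {κ : Colouring s} → Free κ → Reads o (above x κ) → divisions x ≡ 1 →
             Free (above x κ)
free-above {s} {o} {x} {κ} free reads one = free-node (above x κ) (λ { zero → free }) contradictory
  where
  positive : ∀ m → wt divisions (above x κ) m ≢ 0
  positive here           e rewrite one with () ← e
  positive (there zero p) e rewrite one with () ← e
  contradictory : ∀ {u m v} → Fork u m v → Even (above x κ) u m v → ⊥
  contradictory {m = m} {v} vertical even = positive m (vertical-square reads m v even)
  contradictory (fork {zero} {zero} i≢j _) _ = i≢j refl

-- Invariants of subtrees and edges

record Subtree {t} (M o : ℕ) (κ : Colouring t) : Set where
  field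
    reads         : Reads o κ
    free          : Free κ
    uppers<       : ∀ v → wt uppers κ v < M
    lowers<       : ∀ v → wt lowers κ v < M

-- An edge to a subtree, seen from its first division vertex, with x vertices in its upper half
-- and y in its lower half still to come.
record Edge {t} (M x y o : ℕ) (κ : Colouring t) : Set where
  field
    reads     : Reads o κ
    free      : Free κ
    uppers<   : ∀ v → wt uppers κ v < x + M
    lowers<   : ∀ v → wt lowers κ v < y + M
    -- These two fields locate `v`: an original vertex occurs only after the whole lower half, and a
    -- lower vertex only after the whole upper half.
    passes    : ∀ v → wt originals κ v ≡ 0 ⊎ y ≤ wt lowers κ v
    halfway   : ∀ v → wt lowers κ v ≡ 0 ⊎ x ≤ wt uppers κ v
    divisions≢0 : ∀ v → wt divisions κ v ≡ 0 → x ≡ 0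

edge-nil : ∀ {t M o} {κ : Colouring t} → Subtree M o κ → Edge M 0 0 o κ
edge-nil s = record
  { reads = reads ; free = free ; uppers< = uppers< ; lowers< = lowers<
  ; passes = λ _ → inj₂ z≤n ; halfway = λ _ → inj₂ z≤n ; divisions≢0 = λ _ _ → refl }
  where open Subtree s

edge-lower : ∀ {t M y o} {κ : Colouring t} → Edge M 0 y (suc o) κ →
             Edge M 0 (suc y) o (above (lower (w o)) κ)
edge-lower {κ = κ} e = record
  { reads = reads′ ; free = free-above free reads′ refl
  ; uppers< = λ { here → ≤-<-trans z≤n (uppers< here) ; (there zero p) → uppers< p }
  ; lowers< = λ { here → s≤s (≤-<-trans z≤n (lowers< here)) ; (there zero p) → s≤s (lowers< p) }
  ; passes  = λ { here → inj₁ refl ; (there zero p) → map₂ s≤s (passes p) }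
  ; halfway = λ _ → inj₂ z≤n ; divisions≢0 = λ _ _ → refl }
  where
  open Edge e
  reads′ = reads-above (λ _ → refl) refl reads

edge-upper : ∀ {t M x y o} {κ : Colouring t} → Edge M x y (suc o) κ →
             Edge M (suc x) y o (above (upper (w o)) κ)
edge-upper {κ = κ} e = record
  { reads = reads′ ; free = free-above free reads′ refl
  ; uppers< = λ { here → s≤s (≤-<-trans z≤n (uppers< here)) ; (there zero p) → s≤s (uppers< p) }
  ; lowers< = λ { here → ≤-<-trans z≤n (lowers< here) ; (there zero p) → lowers< p }
  ; passes  = λ { here → inj₁ refl ; (there zero p) → passes p }
  ; halfway = λ { here → inj₁ refl ; (there zero p) → map₂ s≤s (halfway p) }
  ; divisions≢0 = λ { here () ; (there zero p) () } }
  where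
  open Edge e
  reads′ = reads-above (λ _ → refl) refl reads

EdgeOn : (M x y o : ℕ) → Tree → Set
EdgeOn M x y o t = Σ (Colouring t) (Edge M x y o)

edge-lowers : ∀ {s M} y {o} → Σ (Colouring s) (Subtree M (y + o)) → EdgeOn M 0 y o (chain y s)
edge-lowers zero (κ , sub) = κ , edge-nil sub
edge-lowers {s} {M} (suc y) {o} sub =
  let κ , e = edge-lowers y (subst (λ z → Σ (Colouring s) (Subtree M z)) (sym (+-suc y o)) sub)
  in above (lower (w o)) κ , edge-lower e

edge-uppers : ∀ {s M} x {y o} → Σ (Colouring s) (Subtree M (y + (x + o))) → EdgeOn M x y o (chain (x + y) s)
edge-uppers zero {y} sub = edge-lowers y sub
edge-uppers {s} {M} (suc x) {y} {o} sub =
  let κ , e = edge-uppers x (subst (λ z → Σ (Colouring s) (Subtree M (y + z))) (sym (+-suc x o)) sub)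
  in above (upper (w o)) κ , edge-upper e

branch : ∀ {ss} → (∀ i → Colouring (lookup ss i)) → Colouring (node ss)
branch κs here        = original
branch κs (there i p) = κs i p

module _ {ss : List Tree} {M o : ℕ} (n : Fin (length ss) → ℕ) (1≤M : 1 ≤ M) (M≤n : ∀ i → M ≤ n i)
         (spread : ∀ i j → i ≢ j → n i + M ≤ n j ⊎ n j + M ≤ n i)
         (κs : ∀ i → Colouring (lookup ss i)) (edges : ∀ i → Edge M (n i) (n i) o (κs i)) where

  private
    κ : Colouring (node ss)
    κ = branch κs

  reads-branch : Reads o κ
  reads-branch = reading λ where
    ω here        → trans (+-identityʳ (S ω o)) (cong (S ω) (sym (+-identityʳ o)))
    ω (there i p) → read (Edge.reads (edges i)) ω p

  1≤n : ∀ i → 1 ≤ n i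
  1≤n i = ≤-trans 1≤M (M≤n i)

  originals≢0 : ∀ v → wt originals κ v ≢ 0
  originals≢0 here        ()
  originals≢0 (there i p) ()

  passed : ∀ j q → wt originals (κs j) q ≢ 0 → n j ≤ wt lowers (κs j) q
  passed j q r≢0 with Edge.passes (edges j) q
  ... | inj₁ r≡0 = ⊥-elim (r≢0 r≡0)
  ... | inj₂ n≤  = n≤

  -- If `m` is the root, the second half needs an original vertex as well, so it contains the lower
  -- half of an edge, whereas the first half has no lower vertex.
  no-vertical : ∀ m v → Even κ here m v → ⊥
  no-vertical (there i p) v even = <⇒≱ (1≤n i) (≤-reflexive
    (Edge.divisions≢0 (edges i) p (vertical-square reads-branch (there i p) v even)))
  no-vertical here here        even with () ← even originals
  no-vertical here (there j q) even = <⇒≱ (1≤n j) (≤-trans (passed j q r≢0)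
    (≤-reflexive (trans (sym (+-identityʳ _)) (sym (even lowers)))))
    where
    r≢0 : wt originals (κs j) q ≢ 0
    r≢0 r≡0 with () ← trans (even originals) (cong (λ r → suc r + 1) r≡0)

  module _ {i j p m q} (i≢j : i ≢ j) (onBranch : m ≡ here ⊎ (∃ λ m′ → m ≡ there j m′))
           (even : Even κ (there i p) m (there j q)) where

    private
      p⁺ = wt uppers (κs i) p
      p⁻ = wt lowers (κs i) p
      m⁺ = wt uppers κ m
      m⁻ = wt lowers κ m
      q⁺ = wt uppers (κs j) q
      q⁻ = wt lowers (κs j) q

    even⁺ : p⁺ + 2 * m⁺ ≡ q⁺
    even⁺ = trans (even uppers) (+-identityʳ q⁺)

    even⁻ : p⁻ + 2 * m⁻ ≡ q⁻
    even⁻ = trans (even lowers) (+-identityʳ q⁻)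

    -- The root makes the first half contain an original vertex, so the second half contains one
    -- too, and `q` lies beyond its first edge.
    n≤q⁻ : n j ≤ q⁻
    n≤q⁻ = passed j q λ r≡0 → <⇒≱ (*-monoʳ-≤ 2 (n≢0⇒n>0 (originals≢0 m)))
      (≤-trans (m≤n+m (2 * wt originals κ m) (wt originals (κs i) p))
               (≤-reflexive (suc-injective (trans (even originals) (cong (λ r → suc r + 1) r≡0)))))

    q⁺< : q⁺ < n j + M
    q⁺< = Edge.uppers< (edges j) q

    -- The second half would have to repeat at least `n j` upper vertices, but fewer than `M`, hence
    -- fewer than `n j`, are left below.
    m-beyond-middle : n j ≤ m⁺ → ⊥
    m-beyond-middle n≤m⁺ = <⇒≱ q⁺< (begin
      n j + M        ≤⟨ +-mono-≤ n≤m⁺ (≤-trans (M≤n j) n≤m⁺) ⟩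
      m⁺ + m⁺        ≡⟨ cong (m⁺ +_) (+-identityʳ m⁺) ⟨
      2 * m⁺         ≤⟨ m≤n+m (2 * m⁺) p⁺ ⟩
      p⁺ + 2 * m⁺    ≡⟨ even⁺ ⟩
      q⁺             ∎)
      where open ≤-Reasoning

    -- Here `p⁻ = q⁻`. If edge `i` is the shorter one, `p` cannot have that many lower vertices; if
    -- it is the longer one, `p` has passed its upper half and has more upper vertices than `q` can
    -- have.
    m-before-middle : m⁻ ≡ 0 → ⊥
    m-before-middle m⁻≡0 with spread i j i≢j
    ... | inj₁ i≪j = <⇒≱ (Edge.lowers< (edges i) p) (≤-trans i≪j (≤-trans n≤q⁻ (≤-reflexive q⁻≡p⁻)))
      where
      q⁻≡p⁻ : q⁻ ≡ p⁻
      q⁻≡p⁻ = trans (sym even⁻) (trans (cong (λ z → p⁻ + 2 * z) m⁻≡0) (+-identityʳ p⁻))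
    ... | inj₂ j≪i with Edge.halfway (edges i) p
    ...   | inj₁ p⁻≡0 = <⇒≱ (1≤n j) (≤-trans n≤q⁻ (≤-reflexive
                          (trans (sym even⁻) (cong₂ (λ y z → y + 2 * z) p⁻≡0 m⁻≡0))))
    ...   | inj₂ n≤p⁺ = <⇒≱ q⁺< (≤-trans j≪i (≤-trans n≤p⁺ (≤-trans (m≤m+n p⁺ (2 * m⁺)) (≤-reflexive even⁺))))

    no-fork : ⊥
    no-fork = cases onBranch
      where
      cases : m ≡ here ⊎ (∃ λ m′ → m ≡ there j m′) → ⊥
      cases (inj₁ e) = m-before-middle (cong (wt lowers κ) e)
      cases (inj₂ (m′ , e)) with Edge.halfway (edges j) m′
      ... | inj₁ m⁻≡0 = m-before-middle (trans (cong (wt lowers κ) e) m⁻≡0)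
      ... | inj₂ n≤m⁺ = m-beyond-middle (subst (n j ≤_) (sym (cong (wt uppers κ) e)) n≤m⁺)

  subtree-branch : ∀ {N} → 1 ≤ N → (∀ i → n i + M ≤ N) → Subtree N o κ
  subtree-branch 1≤N n+M≤N = record
    { reads = reads-branch
    ; free  = free-node κ (Edge.free ∘ edges) λ where
        (vertical {m} {v})   → no-vertical m v
        (fork {p = p} {q = q} i≢j onBranch) → no-fork {p = p} {q = q} i≢j onBranch
    ; uppers< = λ { here → 1≤N ; (there i p) → <-≤-trans (Edge.uppers< (edges i) p) (n+M≤N i) }
    ; lowers< = λ { here → 1≤N ; (there i p) → <-≤-trans (Edge.lowers< (edges i) p) (n+M≤N i) }
    }

-- Recursive construction of the subdivision

module Build (d h : ℕ) where

  K : ℕ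
  K = 2 * d * suc d ^ (h ∸ 1)

  scale : ℕ → ℕ
  scale m = suc d ^ m

  1≤scale : ∀ m → 1 ≤ scale m
  1≤scale m = m^n>0 (suc d) m

  Subdivided : Tree → Tree → Set
  Subdivided t s = Σ ℕ λ j → j ≤ K × Σ Tree λ s′ → s ≡ chain j s′ × Subdiv K t s′

  -- For the i-th edge of a forest whose first edge has number k, counting from 0.
  half : ℕ → ℕ → ℕ → ℕ
  half m k i = suc (k + i) * scale m

  Forest : ℕ → ℕ → ℕ → List Tree → Set
  Forest m k o ss = Σ (∀ i → Colouring (lookup ss i)) λ κs →
                    ∀ i → Edge (scale m) (half m k (toℕ i)) (half m k (toℕ i)) o (κs i)

  cons-forest : ∀ m k {o s ss} → EdgeOn (scale m) (half m k 0) (half m k 0) o s →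
                Forest m (suc k) o ss → Forest m k o (s ∷ ss)
  cons-forest m k {o} {s} {ss} (κ , e) (κs , es) = κs′ , es′
    where
    κs′ : ∀ i → Colouring (lookup (s ∷ ss) i)
    κs′ zero    = κ
    κs′ (suc i) = κs i
    es′ : ∀ i → Edge (scale m) (half m k (toℕ i)) (half m k (toℕ i)) o (κs′ i)
    es′ zero    = e
    es′ (suc i) = subst (λ z → Edge (scale m) (suc z * scale m) (suc z * scale m) o (κs i))
                        (sym (+-suc k (toℕ i))) (es i)

  length-bound : ∀ {m k} → m < h → k < d → half m k 0 + half m k 0 ≤ K
  length-bound {m} {k} m<h k<d = begin
    half m k 0 + half m k 0                ≡⟨ cong (λ z → suc z * scale m + suc z * scale m) (+-identityʳ k) ⟩
    suc k * scale m + suc k * scale m      ≤⟨ +-mono-≤ le le ⟩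
    d * scale (h ∸ 1) + d * scale (h ∸ 1)  ≡⟨ lemma d (scale (h ∸ 1)) ⟩
    K                                      ∎
    where
    open ≤-Reasoning
    le : suc k * scale m ≤ d * scale (h ∸ 1)
    le = *-mono-≤ k<d (^-monoʳ-≤ (suc d) (<⇒≤pred m<h))
    lemma : ∀ x y → x * y + x * y ≡ 2 * x * y
    lemma = solve-∀

  -- Besides separating siblings, the case `j = d` gives the bound `scale (suc m)` for the whole
  -- subtree.
  half-gap : ∀ m {i j} → i < j → half m 0 i + scale m ≤ suc j * scale m
  half-gap m {i} i<j = ≤-trans (≤-reflexive (+-comm (suc i * scale m) (scale m)))
                               (*-monoˡ-≤ (scale m) (s≤s i<j))

  half-spread : ∀ m i j → i ≢ j → half m 0 i + scale m ≤ half m 0 j ⊎ half m 0 j + scale m ≤ half m 0 i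
  half-spread m i j i≢j with <-cmp i j
  ... | tri< i<j _ _ = inj₁ (half-gap m i<j)
  ... | tri≈ _ i≡j _ = ⊥-elim (i≢j i≡j)
  ... | tri> _ _ j<i = inj₂ (half-gap m j<i)

  mutual

    build : ∀ m {T} → DAry d T → height T ≤ m → m ≤ h → ∀ o →
            Σ Tree λ S → Subdiv K T S × Σ (Colouring S) (Subtree (scale m) o)
    build zero {node []} _ _ _ o = node [] , node [] , branch {[]} (λ ()) ,
      subtree-branch {[]} {1} (λ ()) ≤-refl (λ ()) (λ ()) (λ ()) (λ ()) ≤-refl (λ ())
    build zero {node (t ∷ ts)} _ ht _ _ = ⊥-elim (n≮0 (≤-trans (m≤m⊔n (suc (height t)) (heights ts)) ht))
    build (suc m) (node {ts} len ds) ht m<h o =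
      let ss , subdivided , κs , edges = buildForest m {0} ds ht m<h len o
          degree = subst (_≤ d) (Pointwise-length subdivided) len
      in node ss , node subdivided , branch κs ,
         subtree-branch (half m 0 ∘ toℕ) (1≤scale m) (λ i → m≤m+n (scale m) (toℕ i * scale m))
           (λ i j i≢j → half-spread m (toℕ i) (toℕ j) (i≢j ∘ toℕ-injective)) κs edges
           (1≤scale (suc m)) (λ i → half-gap m (≤-trans (toℕ<n i) degree))

    buildForest : ∀ m {k ts} → All (DAry d) ts → heights ts ≤ suc m → m < h → k + length ts ≤ d → ∀ o →
                  Σ (List Tree) λ ss → Pointwise Subdivided ts ss × Forest m k o ss
    buildForest m [] _ _ _ o = [] , [] , (λ ()) , (λ ())
    buildForest m {k} {t ∷ ts} (dt ∷ ds) ht m<h len o =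
      let x = half m k 0
          len′ = subst (_≤ d) (+-suc k (length ts)) len
          -- Each child continues reading where its own edge stops, while all sibling edges start at
          -- `o`.
          s , sub , coloured = build m dt (s≤s⁻¹ (m⊔n≤o⇒m≤o (suc (height t)) (heights ts) ht))
                                     (<⇒≤ m<h) (x + (x + o))
          ss , subs , forest = buildForest m {suc k} ds (m⊔n≤o⇒n≤o (suc (height t)) (heights ts) ht)
                                           m<h len′ o
      in chain (x + x) s ∷ ss ,
         (x + x , length-bound m<h (≤-trans (s≤s (m≤m+n k (length ts))) len′) , s , refl , sub) ∷ subs ,
         cons-forest m k (edge-uppers x coloured) forest

-- Encoding of the colours by numbers

palette : List Colour
palette = original ∷ upper α ∷ upper β ∷ upper γ ∷ upper δ ∷ lower α ∷ lower β ∷ lower γ ∷ lower δ ∷ []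

encode : Colour → Fin 10
encode original  = # 0
encode (upper α) = # 1
encode (upper β) = # 2
encode (upper γ) = # 3
encode (upper δ) = # 4
encode (lower α) = # 5
encode (lower β) = # 6
encode (lower γ) = # 7
encode (lower δ) = # 8

-- Nine colours occur; the number 9 gets the default `original`.
decode : Fin 10 → Colour
decode = nth original palette ∘ toℕ

decode-encode : ∀ x → decode (encode x) ≡ x
decode-encode original  = refl
decode-encode (upper α) = refl
decode-encode (upper β) = refl
decode-encode (upper γ) = refl
decode-encode (upper δ) = refl
decode-encode (lower α) = refl
decode-encode (lower β) = refl
decode-encode (lower γ) = refl
decode-encode (lower δ) = refl

anagram-map : ∀ {A B : Set} (f : A → B) {xs} → Anagram xs → Anagram (map f xs)
anagram-map f ([]    , P , W≢[] , _   , _) = ⊥-elim (W≢[] refl)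
anagram-map f (x ∷ W , P , _ , P↭W , refl) = map f (x ∷ W) , map f P , (λ ()) , ↭-map⁺ f P↭W , map-++ f (x ∷ W) P

encode-free : ∀ {t} {κ : Colouring t} → Free κ → AnagramFree t (encode ∘ κ)
encode-free {κ = κ} free ps path anagram = free ps path (subst Anagram decoded (anagram-map decode anagram))
  where
  decoded : map decode (map (encode ∘ κ) ps) ≡ map κ ps
  decoded = trans (sym (map-∘ ps)) (map-cong (decode-encode ∘ κ) ps)

theorem3 : (d h : ℕ) → 1 ≤ d → 1 ≤ h → (T : Tree) → DAry d T → height T ≡ h →
    Σ Tree λ S → Subdiv (2 * d * suc d ^ (h ∸ 1)) T S × Σ (Pos S → Fin 10) λ c → AnagramFree S c
theorem3 d h _ _ T dary height≡h =
  let S , subdivision , κ , subtree = Build.build d h h dary (≤-reflexive height≡h) ≤-refl 0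
  in S , subdivision , encode ∘ κ , encode-free (Subtree.free subtree)
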